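{- Let $\kappa$ be a weakly compact cardinal and $A$ be a subset of ${}^\kappa\kappa$. Then $A$ satisfies the Hurewicz dichotomy if and only if it satisfies the Miller-tree Hurewicz dichotomy.
   Context: Weakly compact cardinals are uncountable. ${}^\kappa\kappa$ is the set of all functions from $\kappa$ to $\kappa$ with the bounded topology, whose basic open sets are $N_s=\{x\in{}^\kappa\kappa \mid s\subseteq x\}$ for $s\in{}^{<\kappa}\kappa$ (functions from an ordinal ${<}\kappa$ into $\kappa$). $A\subseteq{}^\kappa\kappa$ is $\kappa$-compact if every open cover of $A$ has a subcover of size less than $\kappa$, and $\mathrm{K}_\kappa$ if it is a union of $\kappa$-many $\kappa$-compact subsets of ${}^\kappa\kappa$. A subtree of ${}^{<\kappa}\kappa$ is a subset closed under initial segments; $[T]=\{x\in{}^\kappa\kappa\mid \forall\alpha<\kappa\ (x\restriction\alpha\in T)\}$. A subtree $T$ is superclosed if it is closed under unions of increasing sequences of length ${<}\kappa$. A $\kappa$-Miller tree is a (nonempty) superclosed subtree $T$ such that every $t\in T$ is extended by some $s\in T$ which has at least $\kappa$-many immediate successors in $T$. $A\subseteq{}^\kappa\kappa$ satisfies the Hurewicz dichotomy if either $A$ is contained in a $\mathrm{K}_\kappa$ subset of ${}^\kappa\kappa$, or else $A$ contains a closed subset of ${}^\kappa\kappa$ homeomorphic to ${}^\kappa\kappa$. $A$ satisfies the Miller-tree Hurewicz dichotomy if either $A$ is contained in a $\mathrm{K}_\kappa$ subset of ${}^\kappa\kappa$, or else there is a $\kappa$-Miller tree $T$ with $[T]\subseteq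 A$. -}

module Defs where

open import Axiom.ExcludedMiddle using (ExcludedMiddle)
open import Axiom.Extensionality.Propositional using (Extensionality)
open import Data.Bool.Base using (Bool)
open import Data.Irrelevant using ([_])
open import Data.Nat.Base using (ℕ)
open import Data.Product using (∃-syntax; Σ-syntax; _×_)
open import Data.Refinement using (Refinement-syntax; _,_; value)
open import Data.Sum.Base using (_⊎_)
open import Function.Base using (_∘_)
open import Function.Bundles using (_↣_; _↔_; _⇔_; Injection; Inverse)
open import Induction.WellFounded using (WellFounded)
open import Level using (Level; Setω; suc)
open import Relation.Binary.Core using (Rel)
open import Relation.Binary.Structures using (IsStrictTotalOrder)
open import Relation.Binary.PropositionalEquality.Core using (_≡_)
open import Relation.Nullary.Negation.Core using (¬_)
open import Relation.Unary using (Pred; _⊆_; _∈_; _⊢_; _≐_; ∁; ⋃)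

-- The classical (ZFC) metatheory. No separate axiom of choice is listed:
-- `ExcludedMiddle` decides every type, not only propositions, so it picks an
-- element of each nonempty type. Function extensionality makes `≡` on
-- sequences and on elements of ᵏκ the set-theoretic equality.
record Classical : Setω where
  field
    excludedMiddle : ∀ {a} → ExcludedMiddle a
    extensionality : ∀ {a b} → Extensionality a b

-- A cardinal κ is given by its set of elements (the ordinals below κ)
-- together with their order. An element α : κ also plays the role of the
-- ordinal whose elements form `Below α`, so "an ordinal less than κ" is
-- an element of κ.
module _ {ℓ : Level} (κ : Set ℓ) (_<_ : Rel κ ℓ) where

  -- Membership is irrelevant, so elements of `Below α` are equal exactly when
  -- the underlying elements of κ are.
  Below : κ → Set ℓ
  Below α = [ β ∈ κ ∣ β < α ]

  -- Every f : [κ]² → 2 has a homogeneous set of size κ. The colouring is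
  -- consulted only at pairs α < β; the homogeneous set is the range of an
  -- injection from κ.
  PartitionProperty : Set ℓ
  PartitionProperty =
    (f : κ → κ → Bool) →
    Σ[ H ∈ κ ↣ κ ] ∃[ b ] ∀ i j →
      Injection.to H i < Injection.to H j →
      f (Injection.to H i) (Injection.to H j) ≡ b

  -- κ is an uncountable cardinal (a well-order not equinumerous with any of
  -- its proper initial segments) such that κ → (κ)²₂.
  record IsWeaklyCompact : Set ℓ where
    field
      isStrictTotalOrder : IsStrictTotalOrder _≡_ _<_
      wellFounded        : WellFounded _<_
      initial            : ∀ α → ¬ (κ ↣ Below α)
      uncountable        : ¬ (κ ↣ ℕ)
      partition          : PartitionProperty

  Baire : Set ℓ
  Baire = κ → κ

  -- Elements of ^{<κ}κ.
  record Seq : Set ℓ where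
    constructor seq
    field
      length  : κ
      entries : Below length → κ
  open Seq

  -- (γ , δ) belongs to s, for s regarded as a set of pairs.
  _∋_↦_ : Seq → κ → κ → Set ℓ
  s ∋ γ ↦ δ = Σ[ γ<s ∈ γ < length s ] entries s (γ , [ γ<s ]) ≡ δ

  _⊑_ : Rel Seq ℓ
  s ⊑ t = ∀ γ δ → s ∋ γ ↦ δ → t ∋ γ ↦ δ

  _↾_ : Baire → κ → Seq
  x ↾ α = seq α (x ∘ value)

  N : Seq → Pred Baire ℓ
  N s x = ∀ γ δ → s ∋ γ ↦ δ → x γ ≡ δ

  IsOpen : Pred (Pred Baire ℓ) ℓ
  IsOpen U = ∀ x → x ∈ U → ∃[ s ] x ∈ N s × N s ⊆ U

  IsClosed : Pred (Pred Baire ℓ) ℓ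
  IsClosed C = IsOpen (∁ C)

  Subspace : Pred Baire ℓ → Set ℓ
  Subspace C = [ x ∈ Baire ∣ C x ]

  IsRelativelyOpen : (C : Pred Baire ℓ) → Pred (Pred (Subspace C) ℓ) (suc ℓ)
  IsRelativelyOpen C V = ∃[ W ] IsOpen W × V ≐ (value ⊢ W)

  HomeomorphicToBaire : Pred Baire ℓ → Set (suc ℓ)
  HomeomorphicToBaire C =
    Σ[ h ∈ Subspace C ↔ Baire ]
      (∀ U → IsOpen U → IsRelativelyOpen C (Inverse.to h ⊢ U)) ×
      (∀ V → IsRelativelyOpen C V → IsOpen (Inverse.from h ⊢ V))

  -- A subcover of size less than κ is one enumerated, possibly with
  -- repetitions, by the elements of some α < κ.
  IsκCompact : Pred Baire ℓ → Set (suc ℓ)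
  IsκCompact A =
    (I : Set ℓ) (U : I → Pred Baire ℓ) → (∀ i → IsOpen (U i)) → A ⊆ ⋃ I U →
    ∃[ α ] Σ[ j ∈ (Below α → I) ] A ⊆ ⋃ (Below α) (U ∘ j)

  IsKκ : Pred Baire ℓ → Set (suc ℓ)
  IsKκ B = Σ[ K ∈ (κ → Pred Baire ℓ) ] (∀ i → IsκCompact (K i)) × B ≐ ⋃ κ K

  IsSubtree : Pred Seq ℓ → Set ℓ
  IsSubtree T = ∀ s t → s ⊑ t → t ∈ T → s ∈ T

  Branches : Pred Seq ℓ → Pred Baire ℓ
  Branches T x = ∀ α → (x ↾ α) ∈ T

  IsUnion : ∀ {I : Set ℓ} → Seq → (I → Seq) → Set ℓ
  IsUnion u t = ∀ γ δ → u ∋ γ ↦ δ ⇔ (∃[ i ] t i ∋ γ ↦ δ)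

  IsSuperclosed : Pred Seq ℓ → Set ℓ
  IsSuperclosed T =
    ∀ α (t : Below α → Seq) →
    (∀ β γ → value β < value γ → t β ⊑ t γ) → (∀ β → t β ∈ T) →
    ∀ u → IsUnion u t → u ∈ T

  IsSuccessor : Rel κ ℓ
  IsSuccessor β α = α < β × (∀ γ → γ < β → ¬ (α < γ))

  _IsImmediateSuccessorOf_ : Rel Seq ℓ
  t IsImmediateSuccessorOf s = s ⊑ t × IsSuccessor (length t) (length s)

  HasκManySuccessorsIn : Pred Seq ℓ → Pred Seq ℓ
  HasκManySuccessorsIn T s =
    Σ[ e ∈ κ ↣ Seq ] ∀ i →
      Injection.to e i ∈ T × Injection.to e i IsImmediateSuccessorOf s

  record IsMillerTree (T : Pred Seq ℓ) : Set ℓ where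
    field
      nonempty    : ∃[ t ] t ∈ T
      subtree     : IsSubtree T
      superclosed : IsSuperclosed T
      splitting   : ∀ t → t ∈ T →
                    ∃[ s ] s ∈ T × t ⊑ s × HasκManySuccessorsIn T s

  ContainedInKκ : Pred Baire ℓ → Set (suc ℓ)
  ContainedInKκ A = ∃[ B ] IsKκ B × A ⊆ B

  HurewiczDichotomy : Pred Baire ℓ → Set (suc ℓ)
  HurewiczDichotomy A =
    ContainedInKκ A ⊎
    (∃[ C ] IsClosed C × HomeomorphicToBaire C × C ⊆ A)

  MillerTreeHurewiczDichotomy : Pred Baire ℓ → Set (suc ℓ)
  MillerTreeHurewiczDichotomy A =
    ContainedInKκ A ⊎
    (∃[ T ] IsMillerTree T × Branches T ⊆ A)

{-# OPTIONS --safe #-}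
module Submission where

open import Axiom.ExcludedMiddle using (ExcludedMiddle)
open import Data.Bool.Base using (Bool; true; false)
import Data.Bool.Properties as Bool
open import Data.Empty using (⊥)
open import Data.Irrelevant using ([_])
open import Data.Nat.Base using (ℕ; zero; suc)
open import Data.Product using (∃; _×_; _,_; proj₁; proj₂)
open import Data.Refinement using (_,_; value; value-injective)
open import Data.Sum.Base using (_⊎_; inj₁; inj₂)
open import Data.Unit.Polymorphic.Base using (⊤; tt)
open import Function.Base using (_∘_; id; case_of_)
open import Function.Bundles using (_↣_; _⇔_; Injection; Inverse; Equivalence; mk↣; mk⇔; mk↔ₛ′)
import Induction.WellFounded as WF
open import Level using (Level)
open import Relation.Binary.Core using (Rel)
open import Relation.Binary.Definitions using (tri<; tri≈; tri>)
open import Relation.Binary.PropositionalEquality using (_≡_; _≢_; refl; sym; trans; cong; cong₂; subst)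
open import Relation.Binary.Structures using (IsStrictTotalOrder)
open import Relation.Nullary.Decidable using (Dec; yes; no; does; recompute; decidable-stable; dec-true; dec-false)
open import Relation.Nullary.Negation using (¬_; contradiction)
open import Relation.Unary using (Pred; _∈_; _⊆_; _⊢_)

import Defs as D
open D using (Classical; IsWeaklyCompact)

-- Both implications pass through maps F : ᵏκ → ᵏκ for which the values of F x below some level depend
-- only on x ↾ α, while its value at that level determines x α. The range of such an F is closed and
-- homeomorphic to ᵏκ, and the initial segments of its elements form a κ-Miller tree whose branches are
-- exactly this range. A fusion along the splitting nodes of a κ-Miller tree T gives such an F with range
-- in [T]. Conversely, let g be a homeomorphism of ᵏκ onto a closed set C. For every s, some κ-many
-- points of N s have images under g that split at a single node: take points separated at length s and,
-- by κ → (κ)²₂, a subsequence whose images are lexicographically monotone; if these images did not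
-- split into κ-many directions they would converge in C, contradicting continuity of g⁻¹. Fusing
-- neighbourhoods of these points gives F of the form g ∘ G, with range in C.

module Development (classical : Classical) {ℓ : Level} (κ : Set ℓ) (_<_ : Rel κ ℓ)
  (weaklyCompact : IsWeaklyCompact κ _<_) where

  open Classical classical
  open IsWeaklyCompact weaklyCompact
  open IsStrictTotalOrder isStrictTotalOrder using (compare; irrefl; asym) renaming (trans to <-trans)

  Below = D.Below κ _<_
  Baire = D.Baire κ _<_
  Seq = D.Seq κ _<_
  open D.Seq using (length)
  _∋_↦_ = D._∋_↦_ κ _<_
  _⊑_ = D._⊑_ κ _<_
  _↾_ = D._↾_ κ _<_
  N = D.N κ _<_
  IsOpen = D.IsOpen κ _<_
  IsClosed = D.IsClosed κ _<_
  Subspace = D.Subspace κ _<_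
  IsRelativelyOpen = D.IsRelativelyOpen κ _<_
  HomeomorphicToBaire = D.HomeomorphicToBaire κ _<_
  Branches = D.Branches κ _<_
  IsSuperclosed = D.IsSuperclosed κ _<_
  IsUnion : ∀ {I : Set ℓ} → Seq → (I → Seq) → Set ℓ
  IsUnion = D.IsUnion κ _<_
  IsSuccessor = D.IsSuccessor κ _<_
  IsMillerTree = D.IsMillerTree κ _<_
  HasκManySuccessorsIn = D.HasκManySuccessorsIn κ _<_

  -- Classical logic and choice

  em : ∀ {a} → ExcludedMiddle a
  em = excludedMiddle

  by-contradiction : ∀ {p} {P : Set p} → ¬ ¬ P → P
  by-contradiction = decidable-stable em

  ¬∀⇒∃¬ : ∀ {a p} {A : Set a} {P : A → Set p} → ¬ (∀ x → P x) → ∃ λ x → ¬ P x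
  ¬∀⇒∃¬ ¬∀ = by-contradiction λ ¬∃ → ¬∀ λ x → by-contradiction λ ¬px → ¬∃ (x , ¬px)

  -- A choice operator. The default `d` makes it total, so sequences can be defined one coordinate
  -- at a time before the existence of a witness is known.
  pick : ∀ {a p} {A : Set a} (P : A → Set p) → A → A
  pick P d with em {P = ∃ P}
  ... | yes (x , _) = x
  ... | no _ = d

  pick-satisfies : ∀ {a p} {A : Set a} (P : A → Set p) {d} → ∃ P → P (pick P d)
  pick-satisfies P ∃P with em {P = ∃ P}
  ... | yes (_ , px) = px
  ... | no ¬∃P = contradiction ∃P ¬∃P

  -- The ordinal κ

  induction : ∀ {p} (P : κ → Set p) → (∀ α → (∀ β → β < α → P β) → P α) → ∀ α → P α
  induction P step = WF.All.wfRec wellFounded _ P λ α ih → step α λ β β<α → ih β<α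

  <-irrefl : ∀ {α} → ¬ α < α
  <-irrefl = irrefl refl

  -- ¬ β < α plays the role of α ≤ β.
  ≮-<-trans : ∀ {α β γ} → ¬ β < α → β < γ → α < γ
  ≮-<-trans {α} {β} ≮ β<γ with compare α β
  ... | tri< α<β _ _ = <-trans α<β β<γ
  ... | tri≈ _ refl _ = β<γ
  ... | tri> _ _ β<α = contradiction β<α ≮

  <-≮-trans : ∀ {α β γ} → α < β → ¬ γ < β → α < γ
  <-≮-trans {α} {β} {γ} α<β ≮ with compare β γ
  ... | tri< β<γ _ _ = <-trans α<β β<γ
  ... | tri≈ _ refl _ = α<β
  ... | tri> _ _ γ<β = contradiction γ<β ≮

  least : ∀ {p} (P : κ → Set p) → ∃ P → ∃ λ α → P α × (∀ β → β < α → ¬ P β)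
  least P (α₀ , pα₀) = induction
    (λ α → P α → ∃ λ μ → P μ × (∀ β → β < μ → ¬ P β))
    (λ α ih pα → case em {P = ∃ λ β → β < α × P β} of λ where
      (yes (β , β<α , pβ)) → ih β β<α pβ
      (no none) → α , pα , λ β β<α pβ → none (β , β<α , pβ))
    α₀ pα₀

  member : ∀ {α} (β : Below α) → value β < α
  member (_ , [ β<α ]) = recompute em β<α

  inject-below : ∀ {α} (f : κ → κ) → (∀ {i j} → f i ≡ f j → i ≡ j) → (∀ i → f i < α) → ⊥
  inject-below {α} f f-injective f<α =
    initial α (mk↣ {to = λ i → f i , [ f<α i ]} λ eq → f-injective (cong value eq))

  element : κ
  element with em {P = κ}
  ... | yes α = α
  ... | no empty = contradiction (mk↣ {to = λ α → contradiction α empty} λ {α} → contradiction α empty) uncountable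

  homogeneous-injective : (H : κ ↣ κ) → let open Injection H using (to) in
    ∀ {i j} → i ≢ j → to i < to j ⊎ to j < to i
  homogeneous-injective H {i} {j} i≢j with compare (Injection.to H i) (Injection.to H j)
  ... | tri< lt _ _ = inj₁ lt
  ... | tri≈ _ eq _ = contradiction (Injection.injective H eq) i≢j
  ... | tri> _ _ gt = inj₂ gt

  -- If μ were the maximum, a set homogeneous for the colouring {α < β} ↦ [β ≡ μ] would either avoid μ,
  -- hence lie below it, or consist of μ and at most one other element.
  no-maximum : ∀ μ → ∃ λ β → μ < β
  no-maximum μ = by-contradiction λ maximum →
    let
      (H , c , homogeneous) = partition (λ _ β → does (em {P = β ≡ μ}))
      open Injection H using (to; injective)
      c≡true : ∀ {i j} → to i ≡ μ → to j < to i → c ≡ true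
      c≡true {i} {j} i↦μ j<i = trans (sym (homogeneous j i j<i)) (dec-true em i↦μ)
      c≡false : ∀ {i j} → to i ≢ μ → to j < to i → c ≡ false
      c≡false {i} {j} i↦̸μ j<i = trans (sym (homogeneous j i j<i)) (dec-false em i↦̸μ)
    in case em {P = ∃ λ i → to i ≡ μ} of λ where
      (no avoids) → inject-below to injective λ i → case compare (to i) μ of λ where
        (tri< lt _ _) → lt
        (tri≈ _ eq _) → contradiction (i , eq) avoids
        (tri> _ _ gt) → contradiction (to i , gt) maximum
      (yes (i , i↦μ)) →
        let
          below : ∀ {j} → j ≢ i → to j < to i
          below j≢i = case homogeneous-injective H j≢i of λ where
            (inj₁ lt) → lt
            (inj₂ gt) → contradiction (_ , subst (_< to _) i↦μ gt) maximum
          not-μ : ∀ {j} → j ≢ i → to j ≢ μ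
          not-μ j≢i j↦μ = j≢i (injective (trans j↦μ (sym i↦μ)))
          clash : ∀ {j} → j ≢ i → c ≡ false → ⊥
          clash j≢i c≡f = case trans (sym (c≡true i↦μ (below j≢i))) c≡f of λ ()
          code : ∀ j → Dec (j ≡ i) → ℕ
          code j = λ where
            (yes _) → zero
            (no _) → suc zero
          code-injective : ∀ j k (d : Dec (j ≡ i)) (e : Dec (k ≡ i)) → code j d ≡ code k e → j ≡ k
          code-injective j k = λ where
            (yes refl) (yes refl) _ → refl
            (no j≢i) (no k≢i) _ → by-contradiction λ j≢k → case homogeneous-injective H j≢k of λ where
              (inj₁ j<k) → clash k≢i (c≡false (not-μ k≢i) j<k)
              (inj₂ k<j) → clash j≢i (c≡false (not-μ j≢i) k<j)
        in uncountable (mk↣ {to = λ j → code j em} λ {j} {k} → code-injective j k em em)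

  next-ordinal : ∀ α → ∃ λ β → IsSuccessor β α
  next-ordinal α = least (α <_) (no-maximum α)

  sucκ : κ → κ
  sucκ = proj₁ ∘ next-ordinal

  <sucκ : ∀ {α} → α < sucκ α
  <sucκ {α} = proj₁ (proj₂ (next-ordinal α))

  ≮⇒<sucκ : ∀ {α β} → ¬ α < β → β < sucκ α
  ≮⇒<sucκ ≮ = ≮-<-trans ≮ <sucκ

  injection-unbounded : (H : κ ↣ κ) → ∀ β → ∃ λ i → β < Injection.to H i
  injection-unbounded H β = by-contradiction λ bounded →
    inject-below (Injection.to H) (Injection.injective H) λ i → ≮⇒<sucκ λ β<Hi → bounded (i , β<Hi)

  -- If f were unbounded, assign to each β < κ some p β with f (p β) ≥ β and colour pairs by equality of
  -- their p-values: a homogeneous set is either bounded or injects into α.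
  regular : ∀ {α} (f : Below α → κ) → ∃ λ b → ∀ β → f β < b
  regular {α} f = by-contradiction λ unbounded →
    let
      exceed : ∀ b → ∃ λ β → ¬ f β < b
      exceed b = ¬∀⇒∃¬ λ bound → unbounded (b , bound)
      p : κ → Below α
      p = proj₁ ∘ exceed
      (H , c , homogeneous) = partition (λ β γ → does (em {P = p β ≡ p γ}))
      open Injection H using (to; injective)
      same : ∀ {i j} → c ≡ true → to i < to j → p (to i) ≡ p (to j)
      same {i} {j} c≡true lt = by-contradiction λ ≢ →
        case trans (sym (dec-false em ≢)) (trans (homogeneous i j lt) c≡true) of λ ()
      distinct : ∀ {i j} → c ≡ false → to i < to j → p (to i) ≢ p (to j)
      distinct {i} {j} c≡false lt ≡p =
        case trans (sym (dec-true em ≡p)) (trans (homogeneous i j lt) c≡false) of λ ()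
      constant : c ≡ true → ∀ i → p (to element) ≡ p (to i)
      constant c≡true i = case compare (to element) (to i) of λ where
        (tri< lt _ _) → same c≡true lt
        (tri≈ _ eq _) → cong p eq
        (tri> _ _ gt) → sym (same c≡true gt)
      bounded-range : c ≡ true → ⊥
      bounded-range c≡true = inject-below to injective λ i →
        ≮⇒<sucκ {f (p (to element))} λ lt →
          proj₂ (exceed (to i)) (subst (λ β → f β < to i) (constant c≡true i) lt)
      injective-range : c ≡ false → ⊥
      injective-range c≡false = initial α (mk↣ {to = p ∘ to} λ {i} {j} eq →
        by-contradiction λ i≢j → case homogeneous-injective H i≢j of λ where
          (inj₁ lt) → distinct c≡false lt eq
          (inj₂ gt) → distinct c≡false gt (sym eq))
    in case c Bool.≟ true of λ where
      (yes c≡true) → bounded-range c≡true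
      (no c≢true) → injective-range (Bool.¬-not c≢true)

  upper-bound : ∀ α β → ∃ λ γ → α < γ × β < γ
  upper-bound α β with compare α β
  ... | tri< lt _ _ = sucκ β , <-trans lt <sucκ , <sucκ
  ... | tri≈ _ refl _ = sucκ β , <sucκ , <sucκ
  ... | tri> _ _ gt = sucκ α , <sucκ , <-trans gt <sucκ

  -- Transfinite recursion: by regularity the values chosen before stage `j` lie below a common `b`,
  -- and a single application of `next` to `b` relates all of them to the new value.
  greedy : ∀ {q r} (Q : κ → Set q) (R : κ → κ → Set r) →
    (∀ b → ∃ λ c → Q c × (∀ a → a < b → Q a → R a c)) →
    ∃ λ (m : κ → κ) → (∀ i → Q (m i)) × (∀ i j → i < j → R (m i) (m j))
  greedy Q R next = m , Qm , λ i j i<j → subst (R (m i)) (sym unfold)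
    (proj₂ (proj₂ (next (bound j))) (m i) (proj₂ (regular (m ∘ value)) (i , [ i<j ])) (Qm i))
    where
    step : ∀ i → WF.WfRec _<_ (λ _ → κ) i → κ
    step i rec = proj₁ (next (proj₁ (regular {i} (λ β → rec (member β)))))
    m : κ → κ
    m = WF.All.wfRec wellFounded _ (λ _ → κ) step
    bound : κ → κ
    bound i = proj₁ (regular {i} (m ∘ value))
    unfold : ∀ {i} → m i ≡ proj₁ (next (bound i))
    unfold = WF.FixPoint.unfold-wfRec wellFounded (λ _ → κ) step
      λ i eq → cong (λ f → proj₁ (next (proj₁ (regular {i} f)))) (extensionality λ β → eq (member β))
    Qm : ∀ i → Q (m i)
    Qm i = subst Q (sym unfold) (proj₁ (proj₂ (next (bound i))))

  -- The injection `H` need not be increasing, but it is unbounded: given fewer than `κ` indices,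
  -- regularity bounds their values and some index has a larger one, so `greedy` can thin `H` out.
  increasing-homogeneous : (f : κ → κ → Bool) → ∃ λ (m : κ → κ) → ∃ λ c →
    (∀ i j → i < j → m i < m j) × (∀ i j → i < j → f (m i) (m j) ≡ c)
  increasing-homogeneous f =
    let
      (H , c , homogeneous) = partition f
      open Injection H using (to; injective)
      (m , _ , mono) = greedy (λ _ → ⊤ {ℓ}) (λ a c → to a < to c) λ b →
        let (s , sup) = regular {b} (to ∘ value)
            (i , s<i) = injection-unbounded H s
        in i , tt , λ a a<b _ → <-trans (sup (a , [ a<b ])) s<i
    in to ∘ m , c , mono , λ i j i<j → homogeneous (m i) (m j) (mono i j i<j)

  -- Sequences of points

  _~[_]_ : Baire → κ → Baire → Set ℓ
  x ~[ α ] y = ∀ γ → γ < α → x γ ≡ y γ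

  ~-sym : ∀ {x y α} → x ~[ α ] y → y ~[ α ] x
  ~-sym x~y γ γ<α = sym (x~y γ γ<α)

  ~-trans : ∀ {x y z α} → x ~[ α ] y → y ~[ α ] z → x ~[ α ] z
  ~-trans x~y y~z γ γ<α = trans (x~y γ γ<α) (y~z γ γ<α)

  ConvergesTo : (κ → Baire) → Baire → Set ℓ
  ConvergesTo y x = ∀ α → ∃ λ b → ∀ i → b < i → y i ~[ α ] x

  FansOutAt : κ → (κ → Baire) → Set ℓ
  FansOutAt w y = (∀ i j → y i ~[ w ] y j) × (∀ i j → y i w ≡ y j w → i ≡ j)

  EventuallyConstant : (κ → κ) → Set ℓ
  EventuallyConstant f = ∃ λ v → ∃ λ b → ∀ i → b < i → f i ≡ v

  _<lex_ : Baire → Baire → Set ℓ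
  x <lex y = ∃ λ α → x ~[ α ] y × x α < y α

  -- Each coordinate below `w` stabilises past its own threshold, and regularity bounds these fewer
  -- than `κ` thresholds.
  eventual-stem : ∀ (y : κ → Baire) {w} → (∀ γ → γ < w → EventuallyConstant (λ i → y i γ)) →
    ∃ λ b → ∀ i j → b < i → b < j → y i ~[ w ] y j
  eventual-stem y {w} constant = proj₁ sup , λ i j b<i b<j γ γ<w → trans (at b<i γ γ<w) (sym (at b<j γ γ<w))
    where
    constant-at : (γ : Below w) → EventuallyConstant (λ i → y i (value γ))
    constant-at γ = constant (value γ) (member γ)
    sup = regular (proj₁ ∘ proj₂ ∘ constant-at)
    at : ∀ {i} → proj₁ sup < i → ∀ γ (γ<w : γ < w) → y i γ ≡ proj₁ (constant-at (γ , [ γ<w ]))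
    at b<i γ γ<w = proj₂ (proj₂ (constant-at (γ , [ γ<w ]))) _ (<-trans (proj₂ sup (γ , [ γ<w ])) b<i)

  -- Once the least value attained beyond `b` is reached, a later value can be neither smaller, by
  -- minimality, nor larger, by hypothesis.
  nonascending⇒eventually-constant : (f : κ → κ) (b : κ) → (∀ {i j} → b < i → i < j → ¬ f i < f j) →
    EventuallyConstant f
  nonascending⇒eventually-constant f b nonascending =
    let (v , (i₀ , b<i₀ , fi₀≡v) , minimal) = least (λ v → ∃ λ i → b < i × f i ≡ v) (_ , sucκ b , <sucκ , refl)
    in v , i₀ , λ j i₀<j → case compare (f j) v of λ where
      (tri< lt _ _) → contradiction (j , <-trans b<i₀ i₀<j , refl) (minimal (f j) lt)
      (tri≈ _ eq _) → eq
      (tri> _ _ gt) → contradiction (subst (_< f j) (sym fi₀≡v) gt) (nonascending b<i₀ i₀<j)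

  nondescending⇒increasing-subsequence : (f : κ → κ) (b : κ) → (∀ {i j} → b < i → i < j → ¬ f j < f i) →
    ¬ EventuallyConstant f → ∃ λ (n : κ → κ) → (∀ i → b < n i) × (∀ i j → i < j → f (n i) < f (n j))
  nondescending⇒increasing-subsequence f b nondescending ¬constant =
    greedy (b <_) (λ i j → f i < f j) λ d →
      -- Any earlier choice `a` precedes `e`, hence `f a` is at most `f e`; it suffices to exceed
      -- `f e`.
      let (e , b<e , d<e) = upper-bound b d
          (j , e<j , fe<fj) = exceeds e b<e
      in j , <-trans b<e e<j , λ a a<d b<a → ≮-<-trans (nondescending b<a (<-trans a<d d<e)) fe<fj
    where
    exceeds : ∀ i → b < i → ∃ λ j → i < j × f i < f j
    exceeds i b<i = by-contradiction λ none → ¬constant (f i , i , λ j i<j →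
      case compare (f i) (f j) of λ where
        (tri< lt _ _) → contradiction (j , i<j , lt) none
        (tri≈ _ eq _) → sym eq
        (tri> _ _ gt) → contradiction gt (nondescending b<i i<j))

  increasing⇒injective : (f : κ → κ) → (∀ i j → i < j → f i < f j) → ∀ i j → f i ≡ f j → i ≡ j
  increasing⇒injective f mono i j eq with compare i j
  ... | tri< lt _ _ = contradiction (mono i j lt) (irrefl eq)
  ... | tri≈ _ i≡j _ = i≡j
  ... | tri> _ _ gt = contradiction (mono j i gt) (irrefl (sym eq))

  lex-increasing⇒fans-out : (y : κ → Baire) → (∀ {i j} → i < j → y i <lex y j) →
    ∀ w → (∀ γ → γ < w → EventuallyConstant (λ i → y i γ)) → ¬ EventuallyConstant (λ i → y i w) →
    ∃ λ (n : κ → κ) → FansOutAt w (y ∘ n)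
  lex-increasing⇒fans-out y lex w constant-below ¬constant =
    let (n , b<n , mono) = nondescending⇒increasing-subsequence (λ i → y i w) b nondescending ¬constant
    in n , (λ i j → stem (n i) (n j) (b<n i) (b<n j)) , increasing⇒injective (λ i → y (n i) w) mono
    where
    b = proj₁ (eventual-stem y constant-below)
    stem = proj₂ (eventual-stem y constant-below)
    -- Past the common stem the first lexicographic difference cannot lie below `w`: it is at `w`,
    -- where the values then ascend, or above `w`, where the values at `w` are equal.
    nondescending : ∀ {i j} → b < i → i < j → ¬ y j w < y i w
    nondescending {i} {j} b<i i<j yj<yi = case lex i<j of λ where
      (α , agree , less) → case compare α w of λ where
        (tri< α<w _ _) → irrefl (stem i j b<i (<-trans b<i i<j) α α<w) less
        (tri≈ _ refl _) → asym less yj<yi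
        (tri> _ _ w<α) → irrefl (sym (agree w w<α)) yj<yi

  -- Induction on `w`: when the tails already agree below `w`, an ascent at `w` would be a
  -- lexicographic increase.
  lex-nonincreasing⇒eventually-constant : (y : κ → Baire) → (∀ {i j} → i < j → ¬ y i <lex y j) →
    ∀ w → EventuallyConstant (λ i → y i w)
  lex-nonincreasing⇒eventually-constant y nonincreasing = induction _ λ w ih →
    let (b , stem) = eventual-stem y ih
    in nonascending⇒eventually-constant (λ i → y i w) b λ b<i i<j yi<yj →
      nonincreasing i<j (w , stem _ _ b<i (<-trans b<i i<j) , yi<yj)

  all-eventually-constant⇒converges : (y : κ → Baire) → (∀ w → EventuallyConstant (λ i → y i w)) →
    ∃ (ConvergesTo y)
  all-eventually-constant⇒converges y constant = proj₁ ∘ constant , λ α →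
    let (b , sup) = regular {α} (proj₁ ∘ proj₂ ∘ constant ∘ value)
    in b , λ i b<i γ γ<α → proj₂ (proj₂ (constant γ)) i (<-trans (sup (γ , [ γ<α ])) b<i)

  -- Pass to a subsequence that is lexicographically monotone and let w be the first coordinate at which
  -- it is not eventually constant. By regularity the subsequence eventually agrees below w, so it is
  -- eventually monotone at w. It cannot descend there, as the order is well-founded; hence it ascends
  -- unboundedly.
  converges-or-fans-out : (y : κ → Baire) →
    (∃ λ (m : κ → κ) → (∀ i j → i < j → m i < m j) × ∃ (ConvergesTo (y ∘ m))) ⊎
    (∃ λ w → ∃ λ (m : κ → κ) → FansOutAt w (y ∘ m))
  converges-or-fans-out y = case increasing-homogeneous (λ i j → does (em {P = y i <lex y j})) of λ where
    (m , false , mono , homogeneous) → inj₁ (m , mono ,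
      all-eventually-constant⇒converges (y ∘ m) (lex-nonincreasing⇒eventually-constant (y ∘ m)
        λ {i} {j} i<j lt → case trans (sym (dec-true em lt)) (homogeneous i j i<j) of λ ()))
    (m , true , mono , homogeneous) →
      let
        lex : ∀ {i j} → i < j → y (m i) <lex y (m j)
        lex {i} {j} i<j = by-contradiction λ ≮ → case trans (sym (dec-false em ≮)) (homogeneous i j i<j) of λ ()
      in case em {P = ∀ w → EventuallyConstant (λ i → y (m i) w)} of λ where
        (yes constant) → inj₁ (m , mono , all-eventually-constant⇒converges (y ∘ m) constant)
        (no ¬constant) →
          let (w , ¬constant-w , below) = least (λ w → ¬ EventuallyConstant (λ i → y (m i) w)) (¬∀⇒∃¬ ¬constant)
              (n , fan) = lex-increasing⇒fans-out (y ∘ m) lex w (λ γ γ<w → by-contradiction (below γ γ<w)) ¬constant-w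
          in inj₂ (w , m ∘ n , fan)

  -- Nodes and neighbourhoods

  defined : (s : Seq) → ∀ {γ} → γ < length s → ∃ λ δ → s ∋ γ ↦ δ
  defined s γ<s = _ , γ<s , refl

  Compatible : Seq → Seq → Set ℓ
  Compatible s t = ∀ γ δ δ′ → s ∋ γ ↦ δ → t ∋ γ ↦ δ′ → δ ≡ δ′

  single-valued : ∀ s → Compatible s s
  single-valued s _ _ _ (_ , refl) (_ , refl) = refl

  ⊑⇒compatible : ∀ {s t} → s ⊑ t → Compatible s t
  ⊑⇒compatible {s} {t} s⊑t γ δ δ′ p = single-valued t γ δ δ′ (s⊑t γ δ p)

  Coherent : ∀ {I : Set ℓ} → (I → Seq) → Set ℓ
  Coherent t = ∀ i j → Compatible (t i) (t j)

  increasing⇒coherent : ∀ {I : Set ℓ} (index : I → κ) → (∀ {i j} → index i ≡ index j → i ≡ j) →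
    (t : I → Seq) → (∀ i j → index i < index j → t i ⊑ t j) → Coherent t
  increasing⇒coherent index index-injective t mono i j with compare (index i) (index j)
  ... | tri< lt _ _ = ⊑⇒compatible {t i} {t j} (mono i j lt)
  ... | tri≈ _ eq _ = subst (Compatible (t i) ∘ t) (index-injective eq) (single-valued (t i))
  ... | tri> _ _ gt = λ γ δ δ′ p q → sym (⊑⇒compatible {t j} {t i} (mono j i gt) γ δ′ δ q p)

  ⊑-trans : ∀ {s t u} → s ⊑ t → t ⊑ u → s ⊑ u
  ⊑-trans s⊑t t⊑u γ δ p = t⊑u γ δ (s⊑t γ δ p)

  N-antitone : ∀ {s t x} → s ⊑ t → x ∈ N t → x ∈ N s
  N-antitone s⊑t x∈Nt γ δ p = x∈Nt γ δ (s⊑t γ δ p)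

  N⇒~ : ∀ s {x y} → x ∈ N s → y ∈ N s → x ~[ length s ] y
  N⇒~ s x∈N y∈N γ γ<s = let (δ , p) = defined s γ<s in trans (x∈N γ δ p) (sym (y∈N γ δ p))

  N-resp-~ : ∀ s {x y} → x ∈ N s → x ~[ length s ] y → y ∈ N s
  N-resp-~ s x∈N x~y γ δ (γ<s , eq) = trans (sym (x~y γ γ<s)) (x∈N γ δ (γ<s , eq))

  N⇒~↾ : ∀ {x y α} → y ∈ N (x ↾ α) → x ~[ α ] y
  N⇒~↾ y∈N γ γ<α = sym (y∈N γ _ (γ<α , refl))

  N⇒⊑↾ : ∀ s {x α} → x ∈ N s → ¬ α < length s → s ⊑ (x ↾ α)
  N⇒⊑↾ s x∈N s≤α γ δ (γ<s , eq) = <-≮-trans γ<s s≤α , x∈N γ δ (γ<s , eq)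

  N⇒↾⊑ : ∀ s {x α} → x ∈ N s → ¬ length s < α → (x ↾ α) ⊑ s
  N⇒↾⊑ s {x} x∈N α≤s γ δ (γ<α , eq) =
    let (δ′ , γ<s , eq′) = defined s (<-≮-trans γ<α α≤s)
    in γ<s , trans (trans eq′ (sym (x∈N γ δ′ (γ<s , eq′)))) eq

  ~-mono : ∀ {x y α β} → ¬ β < α → x ~[ β ] y → x ~[ α ] y
  ~-mono α≤β x~y γ γ<α = x~y γ (<-≮-trans γ<α α≤β)

  open-neighbourhood : ∀ {U x} → IsOpen U → x ∈ U → ∃ λ α → ∀ {y} → x ~[ α ] y → y ∈ U
  open-neighbourhood {x = x} U-open x∈U =
    let (s , x∈N , N⊆U) = U-open x x∈U in length s , λ x~y → N⊆U (N-resp-~ s x∈N x~y)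

  N-open : ∀ s → IsOpen (N s)
  N-open s x x∈N = s , x∈N , id

  -- Splitting maps

  record SplittingMap : Set ℓ where
    field
      map        : Baire → Baire
      level      : Baire → κ → κ
      level-cong : ∀ {x y α} → x ~[ α ] y → level x α ≡ level y α
      map-cong   : ∀ {x y α} → x ~[ α ] y → map x ~[ level x α ] map y
      separates  : ∀ {x y α} → x ~[ α ] y → map x (level x α) ≡ map y (level x α) → x α ≡ y α
      level-mono : ∀ {x α β} → α < β → level x α < level x β

  module FromSplittingMap (F : SplittingMap) where
    open SplittingMap F

    Range : Pred Baire ℓ
    Range y = ∃ λ x → map x ≡ y

    Tree : Pred Seq ℓ
    Tree s = ∃ λ x → map x ∈ N s

    -- A drop `level x α < α` would propagate, by monotonicity, to a drop at the smaller ordinal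
    -- `level x α`.
    level-inflationary : ∀ {x} α → ¬ level x α < α
    level-inflationary {x} = induction _ λ α ih lt → ih (level x α) lt (level-mono lt)

    -- Decodes `x` coordinate by coordinate: for `β < α` the level of `β` is below that of `α`, so
    -- `separates` applies. This gives injectivity of `map` and continuity of its inverse.
    reflects : ∀ {x y α} → map x ~[ level x α ] map y → x ~[ α ] y
    reflects {x} {y} {α} agree = induction (λ β → β < α → x β ≡ y β) λ β ih β<α →
      separates (λ γ γ<β → ih γ γ<β (<-trans γ<β β<α)) (agree (level x β) (level-mono β<α))

    map-injective : ∀ {x y} → map x ≡ map y → x ≡ y
    map-injective {x} {y} eq = extensionality λ α →
      reflects {x} {y} (λ γ _ → cong (λ z → z γ) eq) α <sucκ

    map-continuous : ∀ {x y α} → x ~[ α ] y → map x ~[ α ] map y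
    map-continuous {α = α} x~y = ~-mono (level-inflationary α) (map-cong x~y)

    -- Whenever the level of α in map (x i) lies below len i, the value x i α does not depend on i, so
    -- x* can be defined coordinatewise without recursion.
    glue : ∀ {I : Set ℓ} (x : I → Baire) (len : I → κ) →
      (∀ i j γ → γ < len i → γ < len j → map (x i) γ ≡ map (x j) γ) →
      ∃ λ x* → ∀ i → map x* ~[ len i ] map (x i)
    glue {I} x len compatible = x* , agree
      where
      Reaches : I → κ → Set ℓ
      Reaches i α = level (x i) α < len i
      unique : ∀ {i j} α → Reaches i α → Reaches j α → x i α ≡ x j α
      unique {i} {j} = induction _ λ α ih i-reaches j-reaches →
        let
          xi~xj : x i ~[ α ] x j
          xi~xj β β<α = ih β β<α (<-trans (level-mono β<α) i-reaches) (<-trans (level-mono β<α) j-reaches)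
        in separates xi~xj (compatible i j (level (x i) α) i-reaches
             (subst (_< len j) (sym (level-cong xi~xj)) j-reaches))
      Candidate : κ → κ → Set ℓ
      Candidate α v = ∃ λ i → Reaches i α × x i α ≡ v
      -- Coordinates reached by no `x i` receive an arbitrary value.
      x* : Baire
      x* α = pick (Candidate α) α
      x*≡ : ∀ {i α} → Reaches i α → x* α ≡ x i α
      x*≡ {i} {α} reaches =
        let (j , j-reaches , eq) = pick-satisfies (Candidate α) (x i α , i , reaches , refl)
        in trans (sym eq) (unique α j-reaches reaches)
      agree : ∀ i → map x* ~[ len i ] map (x i)
      agree i γ γ<len = case em {P = ∀ α → x* α ≡ x i α} of λ where
        (yes equal) → map-continuous {α = sucκ γ} (λ α _ → equal α) γ <sucκ
        (no differ) →
          -- At the first difference `α`, the level of `α` must be above `γ`, as otherwise `i`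
          -- reaches `α` and `x*≡` applies; below that level `map-cong` gives agreement.
          let (α , ≢ , minimal) = least (λ α → x* α ≢ x i α) (¬∀⇒∃¬ differ)
              xi~x* : x i ~[ α ] x*
              xi~x* β β<α = sym (by-contradiction (minimal β β<α))
          in case em {P = γ < level (x i) α} of λ where
            (yes below) → sym (map-cong xi~x* γ below)
            (no ≮) → contradiction (x*≡ (≮-<-trans ≮ γ<len)) ≢

    -- Used twice: for the initial segments of a branch, and for an increasing sequence of nodes in
    -- the proof of superclosure.
    glue-nodes : ∀ {I : Set ℓ} (t : I → Seq) → Coherent t → (∀ i → t i ∈ Tree) →
      ∃ λ x → ∀ i → map x ∈ N (t i)
    glue-nodes t compatible t∈Tree =
      let (x , agree) = glue (proj₁ ∘ t∈Tree) (length ∘ t) λ i j γ γ<i γ<j →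
            let (δ , p) = defined (t i) γ<i
                (δ′ , q) = defined (t j) γ<j
            in trans (proj₂ (t∈Tree i) γ δ p) (trans (compatible i j γ δ δ′ p q) (sym (proj₂ (t∈Tree j) γ δ′ q)))
      in x , λ i → N-resp-~ (t i) (proj₂ (t∈Tree i)) (~-sym (agree i))

    branches⊆range : Branches Tree ⊆ Range
    branches⊆range {y} branch =
      let (x , map-x∈N) = glue-nodes (y ↾_)
            (λ i j γ δ δ′ → λ where (_ , refl) (_ , refl) → refl) branch
      in x , extensionality λ γ → map-x∈N (sucκ γ) γ (y γ) (<sucκ , refl)

    -- `N (y ↾ α)` meets the range only if `y ↾ α` is in `Tree`; if this happened for every `α`,
    -- then `y` would be a branch and so lie in the range.
    range-closed : IsClosed Range
    range-closed y y∉Range = by-contradiction λ no-neighbourhood → y∉Range (branches⊆range λ α →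
      by-contradiction λ ∉Tree → no-neighbourhood
        (y ↾ α , (λ γ δ p → proj₂ p) , λ y′∈N y′∈Range → ∉Tree
          (proj₁ y′∈Range , subst (N (y ↾ α)) (sym (proj₂ y′∈Range)) y′∈N)))

    tree-superclosed : IsSuperclosed Tree
    tree-superclosed α t mono t∈Tree u u-union =
      let (x , map-x∈N) = glue-nodes t (increasing⇒coherent value value-injective t mono) t∈Tree
      in x , λ γ δ p → let (β , q) = Equivalence.to (u-union γ δ) p in map-x∈N β γ δ q

    update : Baire → κ → κ → Baire
    update x α i β with compare β α
    ... | tri≈ _ _ _ = i
    ... | _ = x β

    update-below : ∀ x α i → x ~[ α ] update x α i
    update-below x α i β β<α with compare β α
    ... | tri< _ _ _ = refl
    ... | tri≈ ≮ _ _ = contradiction β<α ≮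
    ... | tri> _ _ _ = refl

    update-at : ∀ x α i → update x α i α ≡ i
    update-at x α i with compare α α
    ... | tri< _ ≢ _ = contradiction refl ≢
    ... | tri≈ _ _ _ = refl
    ... | tri> _ ≢ _ = contradiction refl ≢

    -- Changing `x` at `α` alone preserves the image below `level x α`, and distinct new values give
    -- distinct images at that level. The successors therefore have length `sucκ (level x α)`, just
    -- enough to include it.
    range-splits : ∀ x α → HasκManySuccessorsIn Tree (map x ↾ level x α)
    range-splits x α = mk↣ {to = child} child-injective , λ i →
      (update x α i , λ _ _ → proj₂) ,
      (λ γ δ (γ<l , eq) → <-trans γ<l <sucκ , trans (sym (map-cong (update-below x α i) γ γ<l)) eq) ,
      proj₂ (next-ordinal (level x α))
      where
      child : κ → Seq
      child i = map (update x α i) ↾ sucκ (level x α)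
      child-at : ∀ i → child i ∋ level x α ↦ map (update x α i) (level x α)
      child-at i = <sucκ , refl
      child-injective : ∀ {i j} → child i ≡ child j → i ≡ j
      child-injective {i} {j} eq =
        let
          l = level x α
          xi~xj = ~-trans {update x α i} {x} {update x α j} (~-sym (update-below x α i)) (update-below x α j)
          at-level = single-valued (child j) l _ _ (subst (_∋ l ↦ map (update x α i) l) eq (child-at i)) (child-at j)
        in trans (sym (update-at x α i)) (trans
             (separates xi~xj (subst (λ l → map (update x α i) l ≡ map (update x α j) l)
               (level-cong (update-below x α i)) at-level))
             (update-at x α j))

    tree-miller : IsMillerTree Tree
    tree-miller = record
      { nonempty    = map id ↾ element , id , λ _ _ → proj₂
      ; subtree     = λ s t s⊑t (x , x∈N) → x , N-antitone {s} {t} s⊑t x∈N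
      ; superclosed = tree-superclosed
      ; splitting   = λ t (x , x∈N) → map x ↾ level x (length t) , (x , λ _ _ → proj₂) ,
                      N⇒⊑↾ t x∈N (level-inflationary (length t)) , range-splits x (length t)
      }

    preimage : (y : Subspace Range) → Range (value y)
    preimage (_ , [ y∈Range ]) = recompute em y∈Range

    range-homeomorphic : HomeomorphicToBaire Range
    range-homeomorphic = mk↔ₛ′ (proj₁ ∘ preimage) (λ x → map x , [ x , refl ])
        -- The witness recovered from the irrelevant membership proof is identified with `x` by
        -- injectivity.
        (λ x → map-injective (proj₂ (preimage (map x , [ x , refl ]))))
        (λ y → value-injective (proj₂ (preimage y))) ,
      image-open , preimage-open
      where
      image-open : ∀ U → IsOpen U → IsRelativelyOpen Range ((proj₁ ∘ preimage) ⊢ U)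
      image-open U U-open = W , (λ y (s , y∈N , s⊆U) → s , y∈N , λ y′∈N → s , y′∈N , s⊆U) ,
        (λ {y} x∈U →
          let (x , x↦y) = preimage y
              (α , near) = open-neighbourhood U-open x∈U
          in map x ↾ level x α , subst (N (map x ↾ level x α)) x↦y (λ _ _ → proj₂) ,
             λ x′ x′∈N → near (reflects {x} {x′} (N⇒~↾ {map x} x′∈N))) ,
        (λ {y} (s , y∈N , s⊆U) →
          let (x , x↦y) = preimage y in s⊆U x (subst (N s) (sym x↦y) y∈N))
        where
        -- The union of all basic open sets whose preimage under `map` lies in `U`.
        W : Pred Baire ℓ
        W y = ∃ λ s → y ∈ N s × (∀ x → map x ∈ N s → x ∈ U)
      preimage-open : ∀ V → IsRelativelyOpen Range V → IsOpen (λ x → V (map x , [ x , refl ]))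
      preimage-open V (W , W-open , V⊆W , W⊆V) x x∈V =
        let (α , near) = open-neighbourhood {W} W-open (V⊆W x∈V)
        in x ↾ α , (λ _ _ → proj₂) , λ x′∈N → W⊆V (near (map-continuous (N⇒~↾ {x} x′∈N)))

  -- Fusion

  supremum : ∀ {α} (f : Below α → κ) → ∃ λ b → (∀ β → ¬ b < f β) × (∀ c → c < b → ¬ (∀ β → ¬ c < f β))
  supremum f = least (λ b → ∀ β → ¬ b < f β) (let (b , f<b) = regular f in b , λ β → asym (f<b β))

  -- The length is the least upper bound, so each coordinate below it is covered by some `t β`. For
  -- empty `Below α` this is the empty sequence, at which the fusion starts.
  union : ∀ {α} → (Below α → Seq) → Seq
  union t = D.seq (proj₁ (supremum (length ∘ t))) (λ γ → pick (λ δ → ∃ λ β → t β ∋ value γ ↦ δ) (value γ))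

  union-isUnion : ∀ {α} (t : Below α → Seq) → Coherent t → IsUnion (union t) t
  union-isUnion t coherent γ δ = mk⇔
    (λ (γ<u , eq) → let (β , γ<tβ) = covered γ<u in subst (λ δ → ∃ λ β → t β ∋ γ ↦ δ) eq
      (pick-satisfies (λ δ → ∃ λ β → t β ∋ γ ↦ δ) (_ , β , γ<tβ , refl)))
    (λ (β , p) → <-≮-trans (proj₁ p) (proj₁ (proj₂ (supremum (length ∘ t))) β) ,
      let (β′ , q) = pick-satisfies (λ δ → ∃ λ β → t β ∋ γ ↦ δ) (δ , β , p) in coherent β′ β γ _ δ q p)
    where
    covered : γ < length (union t) → ∃ λ β → γ < length (t β)
    covered γ<u = let (β , lt) = ¬∀⇒∃¬ (proj₂ (proj₂ (supremum (length ∘ t))) γ γ<u) in β , by-contradiction lt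

  extend : Seq → κ → Baire
  extend s d γ = pick (s ∋ γ ↦_) d

  extend∈N : ∀ s d → extend s d ∈ N s
  extend∈N s d γ δ p = single-valued s γ _ δ (pick-satisfies (s ∋ γ ↦_) (δ , p)) p

  extend-outside : ∀ s d {γ} → ¬ γ < length s → extend s d γ ≡ d
  extend-outside s d {γ} γ≮s with em {P = ∃ (s ∋ γ ↦_)}
  ... | yes (_ , γ<s , _) = contradiction γ<s γ≮s
  ... | no _ = refl

  -- Beyond its length, `s` extends both by the constant `element` and by the constant
  -- `sucκ element`.
  N-determines⇒< : ∀ s {γ} → (∀ x y → x ∈ N s → y ∈ N s → x γ ≡ y γ) → γ < length s
  N-determines⇒< s {γ} determined = by-contradiction λ γ≮s → irrefl
    (trans (sym (extend-outside s element γ≮s))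
      (trans (determined _ _ (extend∈N s element) (extend∈N s (sucκ element))) (extend-outside s (sucκ element) γ≮s)))
    <sucκ

  -- Splitting is measured on images under `g`, while the children are nodes of the domain. This
  -- covers both uses: `g = id` with `P` a Miller tree, and `g` a homeomorphism onto a closed set
  -- with `P` all of `Seq`.
  record IsSplit (g : Baire → Baire) (P : Pred Seq ℓ) (s : Seq) (level : κ) (child : κ → Seq) : Set ℓ where
    field
      child∈     : ∀ i → child i ∈ P
      ⊑child     : ∀ i → s ⊑ child i
      agree      : ∀ i j {x y} → x ∈ N (child i) → y ∈ N (child j) → g x ~[ level ] g y
      determined : ∀ i {x y} → x ∈ N (child i) → y ∈ N (child i) → g x level ≡ g y level
      separated  : ∀ i j {x y} → x ∈ N (child i) → y ∈ N (child j) → g x level ≡ g y level → i ≡ j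

  -- Images of points of `N (child i)` agree up to and including `level`. The children of `t` have
  -- their neighbourhoods inside `N (child i)`, yet their images differ at `level′`. Two distinct
  -- indices suffice: `element` and `sucκ element`.
  split-level-increasing : ∀ {g P s t level level′ child child′} →
    IsSplit g P s level child → IsSplit g P t level′ child′ → ∀ i → child i ⊑ t → level < level′
  split-level-increasing {g} {t = t} {level} {level′} {child} {child′} S S′ i child⊑t =
    by-contradiction λ ≮ → irrefl
      (S′.separated element (sucκ element) (extend∈N (child′ element) element)
        (extend∈N (child′ (sucκ element)) element) (equal ≮)) <sucκ
    where
    module S = IsSplit S
    module S′ = IsSplit S′
    point : κ → Baire
    point j = extend (child′ j) element
    point∈N : ∀ j → point j ∈ N (child i)
    point∈N j = N-antitone {child i} {t} child⊑t
      (N-antitone {t} {child′ j} (S′.⊑child j) (extend∈N (child′ j) element))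
    equal : ∀ {j k} → ¬ level < level′ → g (point j) level′ ≡ g (point k) level′
    equal {j} {k} ≮ with compare level′ level
    ... | tri< lt _ _ = S.agree i i (point∈N j) (point∈N k) level′ lt
    ... | tri≈ _ refl _ = S.determined i (point∈N j) (point∈N k)
    ... | tri> _ _ gt = contradiction gt ≮

  module Fusion (g : Baire → Baire) (P : Pred Seq ℓ) (superclosed : IsSuperclosed P)
    (split : ∀ s → P s → ∃ λ level → ∃ λ child → IsSplit g P s level child) where

    -- Totality lets `node` be defined by recursion before its nodes are known to satisfy `P`;
    -- outside `P` the values are dummies.
    total-split : ∀ s → ∃ λ level → ∃ λ child → P s → IsSplit g P s level child
    total-split s with em {P = P s}
    ... | yes s∈P = let (level , child , is-split) = split s s∈P in level , child , λ _ → is-split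
    ... | no s∉P = length s , (λ _ → s) , λ s∈P → contradiction s∈P s∉P

    level-at : Seq → κ
    level-at = proj₁ ∘ total-split

    child : Seq → κ → Seq
    child = proj₁ ∘ proj₂ ∘ total-split

    is-split : ∀ {s} → P s → IsSplit g P s (level-at s) (child s)
    is-split {s} = proj₂ (proj₂ (total-split s))

    module _ {s : Seq} (s∈P : P s) where
      open IsSplit (is-split s∈P) public

    step : (x : Baire) → ∀ α → WF.WfRec _<_ (λ _ → Seq) α → Seq
    step x α rec = union {α} λ β → child (rec (member β)) (x (value β))

    node : Baire → κ → Seq
    node x = WF.All.wfRec wellFounded ℓ (λ _ → Seq) (step x)

    next-node : Baire → κ → Seq
    next-node x α = child (node x α) (x α)

    node-unfold : ∀ x α → node x α ≡ union {α} (next-node x ∘ value)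
    node-unfold x α = WF.FixPoint.unfold-wfRec wellFounded (λ _ → Seq) (step x)
      λ α eq → cong (union {α}) (extensionality λ β → cong (λ s → child s (x (value β))) (eq (member β)))

    -- Both parts need one induction: the earlier children form an increasing sequence only because
    -- earlier nodes are in `P`, and superclosure then puts their union in `P`.
    node-invariant : ∀ x α → P (node x α) × (∀ β → β < α → next-node x β ⊑ node x α)
    node-invariant x = induction _ λ α ih →
      let
        t : Below α → Seq
        t = next-node x ∘ value
        mono : ∀ β γ → value β < value γ → t β ⊑ t γ
        mono β γ β<γ = let (γ∈P , below) = ih (value γ) (member γ) in
          ⊑-trans {t β} {node x (value γ)} {t γ} (below (value β) β<γ) (⊑child γ∈P (x (value γ)))
        is-union = union-isUnion t (increasing⇒coherent value value-injective t mono)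
      in subst (λ s → P s × (∀ β → β < α → next-node x β ⊑ s)) (sym (node-unfold x α))
           ( superclosed α t mono (λ β → child∈ (proj₁ (ih (value β) (member β))) (x (value β))) (union t) is-union
           , λ β β<α γ δ p → Equivalence.from (is-union γ δ) ((β , [ β<α ]) , p))

    node∈ : ∀ x α → P (node x α)
    node∈ x α = proj₁ (node-invariant x α)

    next-node⊑node : ∀ x {α β} → α < β → next-node x α ⊑ node x β
    next-node⊑node x {α} {β} α<β = proj₂ (node-invariant x β) α α<β

    next-node-mono : ∀ x {α β} → α < β → next-node x α ⊑ next-node x β
    next-node-mono x {α} {β} α<β = ⊑-trans {next-node x α} {node x β} {next-node x β}
      (next-node⊑node x α<β) (⊑child (node∈ x β) (x β))

    next-node-coherent : ∀ x → Coherent (next-node x)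
    next-node-coherent x = increasing⇒coherent id id (next-node x) λ _ _ → next-node-mono x

    node-cong : ∀ {x y} α → x ~[ α ] y → node x α ≡ node y α
    node-cong {x} {y} = induction _ λ α ih x~y → trans (node-unfold x α) (trans
      (cong (union {α}) (extensionality λ β →
        cong₂ child (ih (value β) (member β) λ γ γ<β → x~y γ (<-trans γ<β (member β)))
          (x~y (value β) (member β))))
      (sym (node-unfold y α)))

    limit : Baire → Baire
    limit x γ = pick (λ δ → ∃ λ α → next-node x α ∋ γ ↦ δ) γ

    limit∈N : ∀ x α → limit x ∈ N (next-node x α)
    limit∈N x α γ δ p =
      let (β , q) = pick-satisfies (λ δ → ∃ λ α → next-node x α ∋ γ ↦ δ) (δ , α , p)
      in next-node-coherent x β α γ _ δ q p

    limit∈N-cong : ∀ {x y α} → x ~[ α ] y → limit y ∈ N (child (node x α) (y α))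
    limit∈N-cong {x} {y} {α} x~y =
      subst (λ s → limit y ∈ N (child s (y α))) (sym (node-cong α x~y)) (limit∈N y α)

    level-increasing : ∀ x {α β} → α < β → level-at (node x α) < level-at (node x β)
    level-increasing x {α} {β} α<β = split-level-increasing
      (is-split (node∈ x α)) (is-split (node∈ x β)) (x α) (next-node⊑node x α<β)

    splittingMap : SplittingMap
    splittingMap = record
      { map        = g ∘ limit
      ; level      = λ x α → level-at (node x α)
      ; level-cong = λ {x} {y} {α} x~y → cong level-at (node-cong α x~y)
      ; map-cong   = λ {x} {y} {α} x~y → agree (node∈ x α) (x α) (y α) (limit∈N x α) (limit∈N-cong x~y)
      ; separates  = λ {x} {y} {α} x~y → separated (node∈ x α) (x α) (y α) (limit∈N x α) (limit∈N-cong x~y)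
      ; level-mono = λ {x} → level-increasing x
      }

  -- The two implications

  module ClosedCopyFromMillerTree (T : Pred Seq ℓ) (miller : IsMillerTree T) where
    open D.IsMillerTree miller

    ⊑-antisym : ∀ {s t} → s ⊑ t → t ⊑ s → s ≡ t
    ⊑-antisym {s} {t} s⊑t t⊑s = same (case compare (length s) (length t) of λ where
        (tri< lt _ _) → contradiction (proj₁ (t⊑s _ _ (proj₂ (defined t lt)))) <-irrefl
        (tri≈ _ eq _) → eq
        (tri> _ _ gt) → contradiction (proj₁ (s⊑t _ _ (proj₂ (defined s gt)))) <-irrefl) s⊑t
      where
      same : ∀ {s t} → length s ≡ length t → s ⊑ t → s ≡ t
      same {D.seq α f} {D.seq .α g} refl s⊑t = cong (D.seq α) (extensionality λ β →
        sym (proj₂ (s⊑t (value β) (f β) (member β , refl))))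

    split : ∀ s → T s → ∃ λ level → ∃ λ child → IsSplit id T s level child
    split s s∈T with splitting s s∈T
    ... | s′ , s′∈T , s⊑s′ , e , successors = length s′ , to , record
      { child∈     = proj₁ ∘ successors
      ; ⊑child     = λ i → ⊑-trans {s} {s′} {to i} s⊑s′ (s′⊑ i)
      ; agree      = λ i j x∈N y∈N → N⇒~ s′ (N-antitone {s′} {to i} (s′⊑ i) x∈N) (N-antitone {s′} {to j} (s′⊑ j) y∈N)
      ; determined = λ i x∈N y∈N → N⇒~ (to i) x∈N y∈N (length s′) (proj₁ (proj₂ (proj₂ (successors i))))
      ; separated  = λ i j x∈N y∈N eq → injective
                       (⊑-antisym {to i} {to j} (child⊑ i j x∈N y∈N eq) (child⊑ j i y∈N x∈N (sym eq)))
      }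
      where
      open Injection e using (to; injective)
      s′⊑ : ∀ i → s′ ⊑ to i
      s′⊑ i = proj₁ (proj₂ (successors i))
      -- An immediate successor of `s′` is determined by its entry at `length s′`.
      child⊑ : ∀ i j {x y} → x ∈ N (to i) → y ∈ N (to j) → x (length s′) ≡ y (length s′) → to i ⊑ to j
      child⊑ i j {x} {y} x∈N y∈N eq γ δ (γ<i , p) with compare γ (length s′)
      ... | tri< lt _ _ =
        let (δ′ , q) = defined s′ lt
        in subst (to j ∋ γ ↦_) (single-valued (to i) γ δ′ δ (s′⊑ i γ δ′ q) (γ<i , p)) (s′⊑ j γ δ′ q)
      ... | tri≈ _ refl _ =
        let (δ′ , q) = defined (to j) (proj₁ (proj₂ (proj₂ (successors j))))
        in subst (to j ∋ γ ↦_) (trans (sym (y∈N γ δ′ q)) (trans (sym eq) (x∈N γ δ (γ<i , p)))) q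
      ... | tri> _ _ gt = contradiction gt (proj₂ (proj₂ (proj₂ (successors i))) γ γ<i)

    open Fusion id T superclosed split
    open FromSplittingMap splittingMap public

    -- Since `α` is at most the level at `α`, which lies below the length of `next-node x α`, the
    -- segment `limit x ↾ α` is contained in a node of `T`.
    range⊆branches : Range ⊆ Branches T
    range⊆branches (x , refl) α = subtree (limit x ↾ α) (next-node x α)
      (N⇒↾⊑ (next-node x α) (limit∈N x α) (asym (≮-<-trans (level-inflationary α) level<length)))
      (child∈ (node∈ x α) (x α))
      where
      level<length : level-at (node x α) < length (next-node x α)
      level<length = N-determines⇒< (next-node x α) λ _ _ → determined (node∈ x α) (x α)

  module MillerTreeFromClosedCopy (C : Pred Baire ℓ) (closed : IsClosed C) (homeo : HomeomorphicToBaire C) where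

    h = proj₁ homeo
    open Inverse h using (to; from; strictlyInverseˡ)

    g : Baire → Baire
    g = value ∘ from

    in-C : (y : Subspace C) → C (value y)
    in-C (_ , [ y∈C ]) = recompute em y∈C

    g-continuous : ∀ x β → ∃ λ α → ∀ {y} → x ~[ α ] y → g x ~[ β ] g y
    g-continuous x β =
      let (α , near) = open-neighbourhood
            (proj₂ (proj₂ homeo) (value ⊢ N (g x ↾ β)) (N (g x ↾ β) , N-open (g x ↾ β) , id , id))
            (λ _ _ → proj₂)
      in α , λ x~y → N⇒~↾ {g x} (near x~y)

    to-continuous : ∀ (y : Subspace C) β → ∃ λ α → ∀ y′ → value y ~[ α ] value y′ → to y ~[ β ] to y′
    to-continuous y β =
      let (W , W-open , ⊆W , W⊆) = proj₁ (proj₂ homeo) (N (to y ↾ β)) (N-open (to y ↾ β))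
          (α , near) = open-neighbourhood {W} W-open (⊆W {y} (λ _ _ → proj₂))
      in α , λ y′ y~y′ → N⇒~↾ {to y} (W⊆ {y′} (near y~y′))

    limit∈C : ∀ {y z} → (∀ i → C (y i)) → ConvergesTo y z → C z
    limit∈C {y} {z} y∈C converges = by-contradiction λ z∉C →
      let (α , outside) = open-neighbourhood closed z∉C
          (b , near) = converges α
      in outside (~-sym (near (sucκ b) <sucκ)) (y∈C (sucκ b))

    -- No subsequence of these images can converge: its limit would lie in C, and the inverse of g would
    -- fail to be continuous there, the points extend s i being pairwise separated at length s.
    fan : ∀ s → ∃ λ w → ∃ λ (m : κ → κ) → FansOutAt w (λ i → g (extend s (m i)))
    fan s = case converges-or-fans-out (λ i → g (extend s i)) of λ where
      (inj₂ fans-out) → fans-out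
      (inj₁ (m , mono , z , converges)) →
        let
          z∈C = limit∈C {λ i → g (extend s (m i))} (λ i → in-C (from (extend s (m i)))) converges
          y = z , [ z∈C ]
          -- The bound `sucκ (length s)` includes coordinate `length s`, where `extend s (m i)` has
          -- the value `m i`; the increasing `m` would thus be eventually constant.
          (α , near) = to-continuous y (sucκ (length s))
          (b , close) = converges α
          eventually : ∀ i → b < i → m i ≡ to y (length s)
          eventually i b<i = trans (sym (extend-outside s (m i) <-irrefl)) (trans
            (sym (cong (λ x → x (length s)) (strictlyInverseˡ (extend s (m i)))))
            (sym (near (from (extend s (m i))) (~-sym (close i b<i)) (length s) <sucκ)))
        in contradiction (mono (sucκ b) (sucκ (sucκ b)) <sucκ)
             (irrefl (trans (eventually _ <sucκ) (sym (eventually _ (<-trans <sucκ <sucκ)))))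

    -- By continuity of `g`, a long enough initial segment of `extend s (m i)` fixes the image up to
    -- and including `w`, so the fan of points widens to a fan of neighbourhoods.
    fan⇒split : ∀ s {w} (m : κ → κ) → FansOutAt w (λ i → g (extend s (m i))) →
      ∃ λ child → IsSplit g (λ _ → ⊤ {ℓ}) s w child
    fan⇒split s {w} m (stem , distinct) = child , record
      { child∈     = λ _ → tt
      ; ⊑child     = λ i → N⇒⊑↾ s (extend∈N s (m i)) (asym (proj₁ (proj₂ (bound i))))
      ; agree      = λ i j x∈N y∈N γ γ<w → trans (sym (near i x∈N γ (<-trans γ<w <sucκ)))
                       (trans (stem i j γ γ<w) (near j y∈N γ (<-trans γ<w <sucκ)))
      ; determined = λ i x∈N y∈N → trans (sym (near i x∈N w <sucκ)) (near i y∈N w <sucκ)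
      ; separated  = λ i j x∈N y∈N eq → distinct i j
                       (trans (near i x∈N w <sucκ) (trans eq (sym (near j y∈N w <sucκ))))
      }
      where
      modulus : ∀ i → ∃ λ α → ∀ {y} → extend s (m i) ~[ α ] y → g (extend s (m i)) ~[ sucκ w ] g y
      modulus i = g-continuous (extend s (m i)) (sucκ w)
      bound : ∀ i → ∃ λ α → length s < α × proj₁ (modulus i) < α
      bound i = upper-bound (length s) (proj₁ (modulus i))
      child : κ → Seq
      child i = extend s (m i) ↾ proj₁ (bound i)
      near : ∀ i {x} → x ∈ N (child i) → g (extend s (m i)) ~[ sucκ w ] g x
      near i x∈N = proj₂ (modulus i) (~-mono (asym (proj₂ (proj₂ (bound i)))) (N⇒~↾ {extend s (m i)} x∈N))

    split : ∀ s → ⊤ {ℓ} → ∃ λ level → ∃ λ child → IsSplit g (λ _ → ⊤) s level child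
    split s _ = let (w , m , fans-out) = fan s in w , fan⇒split s m fans-out

    open Fusion g (λ _ → ⊤) (λ _ _ _ _ _ _ → tt) split
    open FromSplittingMap splittingMap public

    branches⊆C : Branches Tree ⊆ C
    branches⊆C branch = let (x , eq) = branches⊆range branch in subst C eq (in-C (from (limit x)))

open import Defs

theorem2p12 : Classical →
    ∀ {ℓ} (κ : Set ℓ) (_<_ : Rel κ ℓ) → IsWeaklyCompact κ _<_ →
    (A : Pred (Baire κ _<_) ℓ) →
    HurewiczDichotomy κ _<_ A ⇔ MillerTreeHurewiczDichotomy κ _<_ A
theorem2p12 classical κ _<_ weaklyCompact A = mk⇔
  (λ where
    (inj₁ contained) → inj₁ contained
    (inj₂ (C , closed , homeo , C⊆A)) →
      let open Development.MillerTreeFromClosedCopy classical κ _<_ weaklyCompact C closed homeo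
      in inj₂ (Tree , tree-miller , C⊆A ∘ branches⊆C))
  (λ where
    (inj₁ contained) → inj₁ contained
    (inj₂ (T , miller , T⊆A)) →
      let open Development.ClosedCopyFromMillerTree classical κ _<_ weaklyCompact T miller
      in inj₂ (Range , range-closed , range-homeomorphic , T⊆A ∘ range⊆branches))
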